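{- Let $d\geq 1$ and let $\mathcal{F}=\{C_0,\ldots,C_d\}$ be a $d$-critical family in $\mathbb{R}^d$. Then there exist $d+1$ base points $p_0,\ldots,p_d$, with $p_i\in\bigcap_{h\neq i}C_h$ for $0\leq i\leq d$, which belong to every convex cage $M$ carried by $\mathcal{F}$.
   Context: A family of compact convex sets $C_0,C_1,\ldots,C_n\subset\mathbb{R}^d$ is called an $n$-critical family if $\bigcap_{i\neq j}C_i\neq\varnothing$ for every $j=0,1,\ldots,n$ (the intersection being over $i\in\{0,\ldots,n\}$, $i\neq j$), but $\bigcap_{i=0}^n C_i=\varnothing$. Here this is used with $n=d$. Given a $d$-critical family $\mathcal{F}=\{C_0,\ldots,C_d\}$ in $\mathbb{R}^d$, a cage (carried by $\mathcal{F}$) is a closed set $M\subseteq\mathbb{R}^d$ containing $d+1$ points $a_0,\ldots,a_d$, called base points, with $a_i\in\bigcap_{h\neq i}C_h$ for $0\leq i\leq d$. A convex cage is a cage that is a convex set. -}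

module Defs where

open import Algebra.Bundles using (CommutativeRing)
open import Data.Fin.Base using (Fin)
open import Data.List.Base using (List)
open import Data.List.Relation.Unary.Any using (Any)
open import Data.Nat.Base using (ℕ; suc)
open import Data.Product.Base using (Σ-syntax; ∃-syntax; _×_)
open import Data.Vec.Functional using (Vector; zipWith)
open import Data.Vec.Functional.Relation.Binary.Pointwise using (Pointwise)
open import Level using (0ℓ) renaming (suc to lsuc)
open import Relation.Binary.Core using (Rel)
open import Relation.Binary.Definitions using (_Respects_)
open import Relation.Binary.PropositionalEquality.Core using (_≢_)
open import Relation.Binary.Structures using (IsTotalOrder)
open import Relation.Nullary.Negation.Core using (¬_)
open import Relation.Unary using (Pred; _∈_; _⊆_; ∁; ⋂; Empty; Satisfiable)
import Algebra.Definitions.RawMonoid as RawMonoidDefs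
import Relation.Binary.Construct.NonStrictToStrict as ToStrict

-- The real numbers, given by their axioms (a Dedekind-complete ordered
-- field).  Classically these determine ℝ up to isomorphism.

record RealNumbers : Set₁ where
  infix 4 _≤_
  field
    commutativeRing : CommutativeRing 0ℓ 0ℓ

  open CommutativeRing commutativeRing public

  field
    _≤_          : Rel Carrier 0ℓ
    isTotalOrder : IsTotalOrder _≈_ _≤_
    0≉1          : ¬ (0# ≈ 1#)
    inverse      : ∀ x → ¬ (x ≈ 0#) → ∃[ y ] (x * y ≈ 1#)
    +-monoˡ-≤    : ∀ z {x y} → x ≤ y → x + z ≤ y + z
    *-nonNeg     : ∀ {x y} → 0# ≤ x → 0# ≤ y → 0# ≤ x * y

  UpperBound : Pred Carrier 0ℓ → Pred Carrier 0ℓ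
  UpperBound P u = ∀ {x} → x ∈ P → x ≤ u

  field
    supremum : (P : Pred Carrier 0ℓ) → Satisfiable P → Satisfiable (UpperBound P) →
               ∃[ s ] (s ∈ UpperBound P × (∀ {u} → u ∈ UpperBound P → s ≤ u))

  open ToStrict _≈_ _≤_ public using (_<_)
  open RawMonoidDefs +-rawMonoid public using (sum)

module Euclidean (ℝ : RealNumbers) where
  open RealNumbers ℝ

  Point : ℕ → Set
  Point d = Vector Carrier d

  infix 4 _≋_
  _≋_ : ∀ {d} → Rel (Point d) 0ℓ
  _≋_ = Pointwise _≈_

  -- Square of the Euclidean distance.
  dist² : ∀ {d} → Point d → Point d → Carrier
  dist² x y = sum (zipWith (λ a b → (a - b) * (a - b)) x y)

  Ball : ∀ {d} → Point d → Carrier → Pred (Point d) 0ℓ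
  Ball x ε y = dist² x y < ε * ε

  IsOpen : ∀ {d} → Pred (Point d) 0ℓ → Set
  IsOpen U = ∀ {x} → x ∈ U → ∃[ ε ] (0# < ε × Ball x ε ⊆ U)

  IsClosed : ∀ {d} → Pred (Point d) 0ℓ → Set
  IsClosed M = IsOpen (∁ M)

  IsCompact : ∀ {d} → Pred (Point d) 0ℓ → Set₁
  IsCompact {d} K =
    (I : Set) (U : I → Pred (Point d) 0ℓ) → (∀ i → IsOpen (U i)) →
    (∀ {x} → x ∈ K → ∃[ i ] x ∈ U i) →
    Σ[ is ∈ List I ] (∀ {x} → x ∈ K → Any (λ i → x ∈ U i) is)

  IsConvex : ∀ {d} → Pred (Point d) 0ℓ → Set
  IsConvex M = ∀ {x y} → x ∈ M → y ∈ M → ∀ t → 0# ≤ t → t ≤ 1# →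
               zipWith (λ a b → (1# - t) * a + t * b) x y ∈ M

  -- The intersection of all members of the family except C j.
  ⋂-except : ∀ {d n} → (Fin n → Pred (Point d) 0ℓ) → Fin n → Pred (Point d) 0ℓ
  ⋂-except C j x = ∀ i → i ≢ j → x ∈ C i

  -- The field `respects` only says that each C i is a subset of the setoid of
  -- points: compactness, unlike closedness, does not imply this.
  record IsCritical {d} (n : ℕ) (C : Fin (suc n) → Pred (Point d) 0ℓ) : Set₁ where
    field
      respects : ∀ i → C i Respects _≋_
      compact  : ∀ i → IsCompact (C i)
      convex   : ∀ i → IsConvex (C i)
      meets    : ∀ j → Satisfiable (⋂-except C j)
      disjoint : Empty (⋂ (Fin (suc n)) C)

  IsBase : ∀ {d} → (Fin (suc d) → Pred (Point d) 0ℓ) → (Fin (suc d) → Point d) → Set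
  IsBase C a = ∀ i → a i ∈ ⋂-except C i

  record IsCage {d} (C : Fin (suc d) → Pred (Point d) 0ℓ) (M : Pred (Point d) 0ℓ) : Set where
    field
      closed : IsClosed M
      base   : Fin (suc d) → Point d
      isBase : IsBase C base
      base∈M : ∀ i → base i ∈ M

  IsConvexCage : ∀ {d} → (Fin (suc d) → Pred (Point d) 0ℓ) → Pred (Point d) 0ℓ → Set
  IsConvexCage C M = IsCage C M × IsConvex M

{-# OPTIONS --safe #-}

-- Let K i be the intersection of all C j with j ≢ i, and let p i be a point of
-- K i nearest to C i.  Moving p i towards a point of C i strictly decreases the
-- distance to C i, so it leaves K i.  Given base points a, take a Radon point z
-- of the d + 2 points p i, a 0, …, a d.  For j ≢ i only a j can fail to lie in
-- C j, and a j occurs on one side of the partition only, so z ∈ K i and hence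
-- z ∉ C i; therefore p i and a i lie on opposite sides.  The side of p i then
-- writes z as a point between p i and C i, which forces z = p i, and the other
-- side writes z as a convex combination of the a j.

module Submission where

open import Defs
open import Algebra.Bundles using (CommutativeRing)
import Algebra.Construct.NaturalChoice.Max
import Algebra.Properties.AbelianGroup
import Algebra.Properties.Group
import Algebra.Properties.Ring
import Algebra.Properties.Semiring.Mult.TCOptimised
import Algebra.Properties.Semiring.Sum
import Algebra.Solver.Ring
open import Algebra.Solver.Ring.AlmostCommutativeRing
  using (_-Raw-AlmostCommutative⟶_; Induced-equivalence; fromCommutativeRing)
open import Axiom.ExcludedMiddle using (ExcludedMiddle)
open import Data.Empty using (⊥-elim)
open import Data.Fin.Base using (Fin; zero; suc; punchIn)
open import Data.Fin.Properties using (_≟_; punchInᵢ≢i)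
open import Data.Integer.Base as ℤ using (ℤ; +_; -[1+_]; _⊖_; _◃_; 0ℤ; 1ℤ)
import Data.Integer.Properties as ℤ
open import Data.List.Base using (List; []; _∷_; mapMaybe)
open import Data.List.Relation.Unary.Any as Any using (Any; here; there)
open import Data.Maybe.Base using (Maybe; just; nothing; maybe′)
open import Data.Nat.Base as ℕ using (ℕ; zero; suc; _≥_; s≤s)
import Data.Nat.Properties as ℕ
open import Data.Product.Base using (Σ-syntax; ∃-syntax; _×_; _,_; proj₁; proj₂)
import Data.Sign.Base as Sign
open import Data.Sum.Base using (_⊎_; inj₁; inj₂; swap; [_,_]′)
open import Data.Vec.Functional using (Vector; zipWith; insertAt; tail; foldr)
  renaming (_∷_ to infixr 5 _◁_)
open import Data.Vec.Functional.Properties using (insertAt-lookup; insertAt-punchIn)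
open import Function.Base using (_∘_; id)
open import Level using (0ℓ)
open import Relation.Binary.Bundles using (TotalOrder)
open import Relation.Binary.Definitions using (_Respects_; WeaklyDecidable)
import Relation.Binary.Properties.TotalOrder
open import Relation.Binary.PropositionalEquality.Core as ≡ using (_≢_)
import Relation.Binary.Reasoning.PartialOrder
import Relation.Binary.Reasoning.Setoid
open import Relation.Nullary.Decidable.Core using (yes; no; decidable-stable)
open import Relation.Nullary.Negation.Core using (¬_)
open import Relation.Unary using (Pred; _∈_; _⊆_; ∁; Satisfiable)

-- The canonical homomorphism from the integers to a commutative ring.

-- Integer coefficients, having decidable equality, let the solver see
-- cancellations such as x - x ≈ 0.
module IntegerSolver {c ℓ} (R : CommutativeRing c ℓ) where
  open CommutativeRing R
  open Algebra.Properties.Ring ring using (-‿distribˡ-*; -‿distribʳ-*)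
  open Algebra.Properties.Group +-group using ()
    renaming (ε⁻¹≈ε to -0≈0; ⁻¹-involutive to -‿involutive)
  open Algebra.Properties.AbelianGroup +-abelianGroup using ()
    renaming (⁻¹-∙-comm to -‿+-comm)
  open Algebra.Properties.Semiring.Mult.TCOptimised semiring renaming (_×_ to _·_)
  open Relation.Binary.Reasoning.Setoid setoid

  -- With the optimised multiple, `1 · 1#` reduces to `1#`, so `1-homo` holds by `refl` and `con 1ℤ`
  -- denotes `1#` itself in solver equations.
  ⟦_⟧ : ℤ → Carrier
  ⟦ + n ⟧      = n · 1#
  ⟦ -[1+ n ] ⟧ = - (suc n · 1#)

  neg-homo : ∀ i → ⟦ ℤ.- i ⟧ ≈ - ⟦ i ⟧
  neg-homo (+ zero)  = sym -0≈0
  neg-homo (+ suc n) = refl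
  neg-homo -[1+ n ]  = sym (-‿involutive _)

  cancel-1 : ∀ a b → (1# + a) - (1# + b) ≈ a - b
  cancel-1 a b = begin
    (1# + a) - (1# + b)     ≈⟨ +-congˡ (-‿+-comm 1# b) ⟨
    (1# + a) + (- 1# - b)   ≈⟨ +-congʳ (+-comm 1# a) ⟩
    (a + 1#) + (- 1# - b)   ≈⟨ +-assoc a 1# _ ⟩
    a + (1# + (- 1# - b))   ≈⟨ +-congˡ (+-assoc 1# (- 1#) (- b)) ⟨
    a + ((1# - 1#) - b)     ≈⟨ +-congˡ (+-congʳ (-‿inverseʳ 1#)) ⟩
    a + (0# - b)            ≈⟨ +-congˡ (+-identityˡ (- b)) ⟩
    a - b                   ∎

  ⊖-homo : ∀ m n → ⟦ m ⊖ n ⟧ ≈ m · 1# - n · 1#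
  ⊖-homo zero    zero    = sym (-‿inverseʳ 0#)
  ⊖-homo zero    (suc n) = sym (+-identityˡ _)
  ⊖-homo (suc m) zero    = sym (trans (+-congˡ -0≈0) (+-identityʳ _))
  ⊖-homo (suc m) (suc n) = begin
    ⟦ suc m ⊖ suc n ⟧         ≡⟨ ≡.cong ⟦_⟧ (ℤ.[1+m]⊖[1+n]≡m⊖n m n) ⟩
    ⟦ m ⊖ n ⟧                           ≈⟨ ⊖-homo m n ⟩
    m · 1# - n · 1#                     ≈⟨ cancel-1 _ _ ⟨
    (1# + m · 1#) - (1# + n · 1#)       ≈⟨ +-cong (1+× m 1#) (-‿cong (1+× n 1#)) ⟨
    suc m · 1# - suc n · 1#             ∎

  +-homo : ∀ i j → ⟦ i ℤ.+ j ⟧ ≈ ⟦ i ⟧ + ⟦ j ⟧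
  +-homo (+ m)    (+ n)    = ×-homo-+ 1# m n
  +-homo (+ m)    -[1+ n ] = ⊖-homo m (suc n)
  +-homo -[1+ m ] (+ n)    = trans (⊖-homo n (suc m)) (+-comm _ _)
  +-homo -[1+ m ] -[1+ n ] = begin
    -- The integer sum reduces to `-[1+ suc (m ℕ.+ n) ]`; one successor is moved next to `n` so that
    -- additivity of multiples applies.
    - (suc (suc m ℕ.+ n) · 1#)        ≡⟨ ≡.cong (λ k → - (k · 1#)) (ℕ.+-suc (suc m) n) ⟨
    - ((suc m ℕ.+ suc n) · 1#)        ≈⟨ -‿cong (×-homo-+ 1# (suc m) (suc n)) ⟩
    - (suc m · 1# + suc n · 1#)       ≈⟨ -‿+-comm _ _ ⟨
    - (suc m · 1#) - suc n · 1#       ∎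

  -◃-homo : ∀ n → ⟦ Sign.- ◃ n ⟧ ≈ - (n · 1#)
  -◃-homo zero    = sym -0≈0
  -◃-homo (suc n) = refl

  *-homo : ∀ i j → ⟦ i ℤ.* j ⟧ ≈ ⟦ i ⟧ * ⟦ j ⟧
  *-homo (+ m)    (+ n)    = begin
    ⟦ + m ℤ.* + n ⟧         ≡⟨ ≡.cong ⟦_⟧ (ℤ.pos-* m n) ⟨
    (m ℕ.* n) · 1#          ≈⟨ ×1-homo-* m n ⟩
    (m · 1#) * (n · 1#)     ∎
  *-homo (+ m)    -[1+ n ] = begin
    ⟦ Sign.- ◃ m ℕ.* suc n ⟧      ≈⟨ -◃-homo (m ℕ.* suc n) ⟩
    - ((m ℕ.* suc n) · 1#)        ≈⟨ -‿cong (×1-homo-* m (suc n)) ⟩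
    - ((m · 1#) * (suc n · 1#))   ≈⟨ -‿distribʳ-* _ _ ⟩
    (m · 1#) * - (suc n · 1#)     ∎
  *-homo -[1+ m ] (+ n)    = begin
    ⟦ Sign.- ◃ suc m ℕ.* n ⟧      ≈⟨ -◃-homo (suc m ℕ.* n) ⟩
    - ((suc m ℕ.* n) · 1#)        ≈⟨ -‿cong (×1-homo-* (suc m) n) ⟩
    - ((suc m · 1#) * (n · 1#))   ≈⟨ -‿distribˡ-* _ _ ⟩
    - (suc m · 1#) * (n · 1#)     ∎
  *-homo -[1+ m ] -[1+ n ] = begin
    (suc m ℕ.* suc n) · 1#              ≈⟨ ×1-homo-* (suc m) (suc n) ⟩
    (suc m · 1#) * (suc n · 1#)         ≈⟨ -‿involutive _ ⟨
    - - ((suc m · 1#) * (suc n · 1#))   ≈⟨ -‿cong (-‿distribˡ-* _ _) ⟩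
    - (- (suc m · 1#) * (suc n · 1#))   ≈⟨ -‿distribʳ-* _ _ ⟩
    - (suc m · 1#) * - (suc n · 1#)     ∎

  morphism : ℤ.+-*-rawRing -Raw-AlmostCommutative⟶ fromCommutativeRing R
  morphism = record
    { ⟦_⟧    = ⟦_⟧
    ; +-homo = +-homo
    ; *-homo = *-homo
    ; -‿homo = neg-homo
    ; 0-homo = refl
    ; 1-homo = refl
    }

  _coeff≟_ : WeaklyDecidable (Induced-equivalence morphism)
  i coeff≟ j with i ℤ.≟ j
  ... | yes ≡.refl = just refl
  ... | no _       = nothing

  open Algebra.Solver.Ring ℤ.+-*-rawRing (fromCommutativeRing R) morphism _coeff≟_ public
    using (solve; _:=_; _:+_; _:*_; _:-_; :-_; con)

-- Ordered field arithmetic, finite sums and linear dependence.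

module OrderedField (em : ExcludedMiddle 0ℓ) (ℝ : RealNumbers) where
  open RealNumbers ℝ hiding (zero)
  open Algebra.Properties.Semiring.Sum semiring public
    using (sum-remove; sum-cong-≋; sum-replicate-zero; ∑-distrib-+; *-distribˡ-sum; *-distribʳ-sum)
  open IntegerSolver commutativeRing public using (solve; _:=_; _:+_; _:*_; _:-_; :-_; con)

  totalOrder : TotalOrder 0ℓ 0ℓ 0ℓ
  totalOrder = record { isTotalOrder = isTotalOrder }

  module ≤ = TotalOrder totalOrder
  open Relation.Binary.Properties.TotalOrder totalOrder public
    using (≰⇒>; <⇒≱; <⇒≉; ≤∧≉⇒<; <-respˡ-≈; <-respʳ-≈; <-irrefl; <-trans)
  open Algebra.Construct.NaturalChoice.Max totalOrder public
    using (_⊔_; ⊔-sel; x≤x⊔y; x≤y⊔x; ⊔-lub; x≤y⇒x⊔y≈y; x≤y⇒y⊔x≈y)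
  module ≤-Reasoning = Relation.Binary.Reasoning.PartialOrder ≤.poset
  open ≤-Reasoning

  +-mono-≤ : ∀ {a b x y} → a ≤ b → x ≤ y → a + x ≤ b + y
  +-mono-≤ {a} {b} {x} {y} a≤b x≤y = begin
    a + x  ≤⟨ +-monoˡ-≤ x a≤b ⟩
    b + x  ≈⟨ +-comm b x ⟩
    x + b  ≤⟨ +-monoˡ-≤ b x≤y ⟩
    y + b  ≈⟨ +-comm y b ⟩
    b + y  ∎

  x≤y⇒0≤y-x : ∀ {x y} → x ≤ y → 0# ≤ y - x
  x≤y⇒0≤y-x {x} {y} x≤y = begin
    0#     ≈⟨ -‿inverseʳ x ⟨
    x - x  ≤⟨ +-monoˡ-≤ (- x) x≤y ⟩
    y - x  ∎

  0≤y-x⇒x≤y : ∀ {x y} → 0# ≤ y - x → x ≤ y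
  0≤y-x⇒x≤y {x} {y} 0≤y-x = begin
    x            ≈⟨ +-identityˡ x ⟨
    0# + x       ≤⟨ +-monoˡ-≤ x 0≤y-x ⟩
    (y - x) + x  ≈⟨ solve 2 (λ x y → (y :- x) :+ x := y) refl x y ⟩
    y            ∎

  x<y⇒0<y-x : ∀ {x y} → x < y → 0# < y - x
  x<y⇒0<y-x {x} {y} x<y = ≰⇒> λ y-x≤0 → <⇒≱ x<y (begin
    y            ≈⟨ solve 2 (λ x y → y := (y :- x) :+ x) refl x y ⟩
    (y - x) + x  ≤⟨ +-monoˡ-≤ x y-x≤0 ⟩
    0# + x       ≈⟨ +-identityˡ x ⟩
    x            ∎)

  x≤0⇒0≤-x : ∀ {x} → x ≤ 0# → 0# ≤ - x
  x≤0⇒0≤-x {x} x≤0 = begin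
    0#      ≤⟨ x≤y⇒0≤y-x x≤0 ⟩
    0# - x  ≈⟨ +-identityˡ (- x) ⟩
    - x     ∎

  0≤x⇒-x≤0 : ∀ {x} → 0# ≤ x → - x ≤ 0#
  0≤x⇒-x≤0 {x} 0≤x = 0≤y-x⇒x≤y (begin
    0#        ≤⟨ 0≤x ⟩
    x         ≈⟨ solve 1 (λ x → x := con 0ℤ :- (:- x)) refl x ⟩
    0# - - x  ∎)

  *-monoˡ-≤ : ∀ {c x y} → 0# ≤ c → x ≤ y → c * x ≤ c * y
  *-monoˡ-≤ {c} {x} {y} 0≤c x≤y = 0≤y-x⇒x≤y (begin
    0#             ≤⟨ *-nonNeg 0≤c (x≤y⇒0≤y-x x≤y) ⟩
    c * (y - x)    ≈⟨ solve 3 (λ c x y → c :* (y :- x) := c :* y :- c :* x) refl c x y ⟩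
    c * y - c * x  ∎)

  *-mono-≤ : ∀ {a b x y} → 0# ≤ b → 0# ≤ x → a ≤ b → x ≤ y → a * x ≤ b * y
  *-mono-≤ {a} {b} {x} {y} 0≤b 0≤x a≤b x≤y = begin
    a * x  ≈⟨ *-comm a x ⟩
    x * a  ≤⟨ *-monoˡ-≤ 0≤x a≤b ⟩
    x * b  ≈⟨ *-comm x b ⟩
    b * x  ≤⟨ *-monoˡ-≤ 0≤b x≤y ⟩
    b * y  ∎

  square-nonNeg : ∀ x → 0# ≤ x * x
  square-nonNeg x with ≤.total 0# x
  ... | inj₁ 0≤x = *-nonNeg 0≤x 0≤x
  ... | inj₂ x≤0 = begin
    0#         ≤⟨ *-nonNeg (x≤0⇒0≤-x x≤0) (x≤0⇒0≤-x x≤0) ⟩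
    - x * - x  ≈⟨ solve 1 (λ x → :- x :* :- x := x :* x) refl x ⟩
    x * x      ∎

  0<1 : 0# < 1#
  0<1 = ≤∧≉⇒< (≤.trans (square-nonNeg 1#) (≤.reflexive (*-identityˡ 1#))) 0≉1

  *-cancelˡ : ∀ {c x y} → ¬ (c ≈ 0#) → c * x ≈ c * y → x ≈ y
  *-cancelˡ {c} {x} {y} c≉0 cx≈cy with b , cb≈1 ← inverse c c≉0 = begin-equality
    x            ≈⟨ *-identityˡ x ⟨
    1# * x       ≈⟨ *-congʳ cb≈1 ⟨
    (c * b) * x  ≈⟨ solve 3 (λ c b x → (c :* b) :* x := b :* (c :* x)) refl c b x ⟩
    b * (c * x)  ≈⟨ *-congˡ cx≈cy ⟩
    b * (c * y)  ≈⟨ solve 3 (λ c b x → b :* (c :* x) := (c :* b) :* x) refl c b y ⟩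
    (c * b) * y  ≈⟨ *-congʳ cb≈1 ⟩
    1# * y       ≈⟨ *-identityˡ y ⟩
    y            ∎

  *-≉0 : ∀ {x y} → ¬ (x ≈ 0#) → ¬ (y ≈ 0#) → ¬ (x * y ≈ 0#)
  *-≉0 {x} x≉0 y≉0 xy≈0 = y≉0 (*-cancelˡ x≉0 (trans xy≈0 (sym (zeroʳ x))))

  *-pos : ∀ {x y} → 0# < x → 0# < y → 0# < x * y
  *-pos 0<x 0<y = ≤∧≉⇒< (*-nonNeg (proj₁ 0<x) (proj₁ 0<y))
    (*-≉0 (<⇒≉ 0<x ∘ sym) (<⇒≉ 0<y ∘ sym) ∘ sym)

  positive-inverse : ∀ {x} → 0# < x → ∃[ y ] (x * y ≈ 1# × 0# < y)
  positive-inverse {x} 0<x with y , xy≈1 ← inverse x (<⇒≉ 0<x ∘ sym) =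
    y , xy≈1 , ≰⇒> λ y≤0 → <⇒≱ 0<1 (begin
      1#            ≈⟨ xy≈1 ⟨
      x * y         ≤⟨ *-monoˡ-≤ (proj₁ 0<x) y≤0 ⟩
      x * 0#        ≈⟨ zeroʳ x ⟩
      0#            ∎)

  contract-< : ∀ {t x} → 0# < t → 0# < x → (1# - t) * x < x
  contract-< {t} {x} 0<t 0<x = ≰⇒> λ x≤ → <⇒≱ (*-pos 0<t 0<x) (begin
    t * x             ≈⟨ solve 2 (λ t x → t :* x := x :- (con 1ℤ :- t) :* x) refl t x ⟩
    x - (1# - t) * x  ≤⟨ +-monoˡ-≤ (- ((1# - t) * x)) x≤ ⟩
    _                 ≈⟨ -‿inverseʳ ((1# - t) * x) ⟩
    0#                ∎)

  sum-nonNeg : ∀ {n} {w : Vector Carrier n} → (∀ j → 0# ≤ w j) → 0# ≤ sum w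
  sum-nonNeg {zero}  0≤w = ≤.refl
  sum-nonNeg {suc n} {w} 0≤w = begin
    0#                    ≈⟨ +-identityˡ 0# ⟨
    0# + 0#               ≤⟨ +-mono-≤ (0≤w zero) (sum-nonNeg (0≤w ∘ suc)) ⟩
    w zero + sum (tail w) ∎

  summand≤sum : ∀ {n} {w : Vector Carrier n} → (∀ j → 0# ≤ w j) → ∀ j → w j ≤ sum w
  summand≤sum {w = w} 0≤w zero = begin
    w zero                ≈⟨ +-identityʳ (w zero) ⟨
    w zero + 0#           ≤⟨ +-mono-≤ ≤.refl (sum-nonNeg (0≤w ∘ suc)) ⟩
    w zero + sum (tail w) ∎
  summand≤sum {w = w} 0≤w (suc j) = begin
    w (suc j)             ≤⟨ summand≤sum (0≤w ∘ suc) j ⟩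
    sum (tail w)          ≈⟨ +-identityˡ _ ⟨
    0# + sum (tail w)     ≤⟨ +-monoˡ-≤ _ (0≤w zero) ⟩
    w zero + sum (tail w) ∎

  sum≈0⇒≈0 : ∀ {n} {w : Vector Carrier n} → (∀ j → 0# ≤ w j) → sum w ≈ 0# → ∀ j → w j ≈ 0#
  sum≈0⇒≈0 0≤w ∑w≈0 j = ≤.antisym (≤.trans (summand≤sum 0≤w j) (≤.reflexive ∑w≈0)) (0≤w j)

  sum-zero : ∀ {n} {w : Vector Carrier n} → (∀ j → w j ≈ 0#) → sum w ≈ 0#
  sum-zero {n} w≈0 = trans (sum-cong-≋ w≈0) (sum-replicate-zero n)

  sum-pos : ∀ {n} {w : Vector Carrier n} → (∀ j → 0# ≤ w j) → ∀ {j} → ¬ (w j ≈ 0#) → 0# < sum w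
  sum-pos 0≤w {j} wj≉0 = ≤∧≉⇒< (sum-nonNeg 0≤w) λ 0≈∑w → wj≉0 (sum≈0⇒≈0 0≤w (sym 0≈∑w) j)

  -- Gaussian elimination, by induction on the dimension. If all first coordinates vanish, that
  -- coordinate is dropped together with one vector. Otherwise a pivot clears the first coordinate
  -- of the other vectors, and a dependence among the cleared vectors extends to the pivot.
  linear-dependence : ∀ {n} (v : Fin (suc n) → Vector Carrier n) →
    Σ[ l ∈ Vector Carrier (suc n) ] ((∃[ j ] ¬ (l j ≈ 0#)) × ∀ k → sum (λ j → l j * v j k) ≈ 0#)
  linear-dependence {zero} v = (λ _ → 1#) , (zero , 0≉1 ∘ sym) , λ ()
  linear-dependence {suc n} v with em {∃[ j ] ¬ (v j zero ≈ 0#)}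
  ... | no  ∄pivot = l , nontrivial , dependent
    where
    ih = linear-dependence (λ j k → v (suc j) (suc k))
    l : Vector Carrier (suc (suc n))
    l = 0# ◁ proj₁ ih
    nontrivial : ∃[ j ] ¬ (l j ≈ 0#)
    nontrivial with j , lj≉0 ← proj₁ (proj₂ ih) = suc j , lj≉0
    dependent : ∀ k → sum (λ j → l j * v j k) ≈ 0#
    dependent zero    = sum-zero λ j → trans
      (*-congˡ (decidable-stable em λ vj≉0 → ∄pivot (j , vj≉0))) (zeroʳ (l j))
    dependent (suc k) = trans (+-cong (zeroˡ _) (proj₂ (proj₂ ih) k)) (+-identityˡ 0#)
  ... | yes (p , vp≉0) = l , nontrivial , dependent
    where
    b = proj₁ (inverse (v p zero) vp≉0)

    c : Vector Carrier (suc n)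
    c i = v (punchIn p i) zero * b

    w : Fin (suc n) → Vector Carrier (suc n)
    w i k = v (punchIn p i) k - c i * v p k

    w-zero : ∀ i → w i zero ≈ 0#
    w-zero i = begin-equality
      v₀ - (v₀ * b) * v p zero  ≈⟨ solve 3 (λ x b y → x :- (x :* b) :* y := x :- x :* (y :* b))
                                       refl v₀ b (v p zero) ⟩
      v₀ - v₀ * (v p zero * b)  ≈⟨ +-congˡ (-‿cong (*-congˡ (proj₂ (inverse (v p zero) vp≉0)))) ⟩
      v₀ - v₀ * 1#              ≈⟨ solve 1 (λ x → x :- x :* con 1ℤ := con 0ℤ) refl v₀ ⟩
      0#                        ∎
      where v₀ = v (punchIn p i) zero

    ih = linear-dependence (λ i k → w i (suc k))
    y = proj₁ ih

    -- The induction hypothesis speaks of the coordinates `suc k` only; coordinate `zero` is the one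
    -- that was cleared.
    y-dependent : ∀ k → sum (λ i → y i * w i k) ≈ 0#
    y-dependent zero    = sum-zero λ i → trans (*-congˡ (w-zero i)) (zeroʳ (y i))
    y-dependent (suc k) = proj₂ (proj₂ ih) k

    -- Replacing each `w i` by the original vector adds `sum (λ i → y i * c i)` times the pivot;
    -- this weight of the pivot cancels it.
    l₀ = - sum (λ i → y i * c i)

    l : Vector Carrier (suc (suc n))
    l = insertAt y p l₀

    nontrivial : ∃[ j ] ¬ (l j ≈ 0#)
    nontrivial with i , yi≉0 ← proj₁ (proj₂ ih) =
      punchIn p i , λ l≈0 → yi≉0 (trans (reflexive (≡.sym (insertAt-punchIn y p l₀ i))) l≈0)

    dependent : ∀ k → sum (λ j → l j * v j k) ≈ 0#
    dependent k = begin-equality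
      sum (λ j → l j * v j k)
        ≈⟨ sum-remove {i = p} (λ j → l j * v j k) ⟩
      l p * v p k + sum (λ i → l (punchIn p i) * v (punchIn p i) k)
        ≈⟨ +-cong (*-congʳ (reflexive (insertAt-lookup y p l₀)))
                  (sum-cong-≋ λ i → *-congʳ {v (punchIn p i) k} (reflexive (insertAt-punchIn y p l₀ i))) ⟩
      l₀ * v p k + sum (λ i → y i * v (punchIn p i) k)
        ≈⟨ +-congˡ (sum-cong-≋ λ i → solve 4 (λ y u c x → y :* u := y :* (u :- c :* x) :+ (y :* c) :* x)
                     refl (y i) (v (punchIn p i) k) (c i) (v p k)) ⟩
      l₀ * v p k + sum (λ i → y i * w i k + (y i * c i) * v p k)
        ≈⟨ +-congˡ (∑-distrib-+ (λ i → y i * w i k) (λ i → (y i * c i) * v p k)) ⟩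
      l₀ * v p k + (sum (λ i → y i * w i k) + sum (λ i → (y i * c i) * v p k))
        ≈⟨ +-congˡ (+-cong (y-dependent k) (sym (*-distribʳ-sum (v p k) (λ i → y i * c i)))) ⟩
      l₀ * v p k + (0# + sum (λ i → y i * c i) * v p k)
        ≈⟨ solve 2 (λ s x → (:- s) :* x :+ (con 0ℤ :+ s :* x) := con 0ℤ) refl (sum (λ i → y i * c i)) (v p k) ⟩
      0# ∎

-- Radon partitions and convex combinations.

module Convexity (em : ExcludedMiddle 0ℓ) (ℝ : RealNumbers) where
  open RealNumbers ℝ hiding (zero)
  open Euclidean ℝ
  open OrderedField em ℝ
  open ≤-Reasoning

  infix 8 _⁺ _⁻
  _⁺ _⁻ : Carrier → Carrier
  x ⁺ = x ⊔ 0#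
  x ⁻ = - x ⊔ 0#

  ⁺-nonNeg : ∀ x → 0# ≤ x ⁺
  ⁺-nonNeg x = x≤y⊔x x 0#

  ⁻-nonNeg : ∀ x → 0# ≤ x ⁻
  ⁻-nonNeg x = x≤y⊔x (- x) 0#

  sign-cases : ∀ x → (x ⁺ ≈ x × x ⁻ ≈ 0#) ⊎ (x ⁺ ≈ 0# × x ⁻ ≈ - x)
  sign-cases x = [ (λ 0≤x → inj₁ (x≤y⇒y⊔x≈y 0≤x , x≤y⇒x⊔y≈y (0≤x⇒-x≤0 0≤x)))
                 , (λ x≤0 → inj₂ (x≤y⇒x⊔y≈y x≤0 , x≤y⇒y⊔x≈y (x≤0⇒0≤-x x≤0))) ]′ (≤.total 0# x)

  ⁺-⁻ : ∀ x → (x ⁺) - (x ⁻) ≈ x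
  ⁺-⁻ x with sign-cases x
  ... | inj₁ (⁺≈ , ⁻≈) = trans (+-cong ⁺≈ (-‿cong ⁻≈)) (solve 1 (λ x → x :- con 0ℤ := x) refl x)
  ... | inj₂ (⁺≈ , ⁻≈) = trans (+-cong ⁺≈ (-‿cong ⁻≈)) (solve 1 (λ x → con 0ℤ :- (:- x) := x) refl x)

  ⁺≈0⊎⁻≈0 : ∀ x → x ⁺ ≈ 0# ⊎ x ⁻ ≈ 0#
  ⁺≈0⊎⁻≈0 x with sign-cases x
  ... | inj₁ (_ , ⁻≈0) = inj₂ ⁻≈0
  ... | inj₂ (⁺≈0 , _) = inj₁ ⁺≈0

  -- Moving the negative coefficients to the other side turns a linear relation into an equality of
  -- two nonnegative combinations, as Radon's theorem requires.
  sum-⁺-⁻ : ∀ {n} (l x : Vector Carrier n) → sum (λ j → l j * x j) ≈ 0# →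
            sum (λ j → (l j ⁺) * x j) ≈ sum (λ j → (l j ⁻) * x j)
  sum-⁺-⁻ l x ∑lx≈0 = begin-equality
    sum (λ j → (l j ⁺) * x j)
      ≈⟨ sum-cong-≋ (λ j → trans
           (solve 3 (λ p n x → p :* x := (p :- n) :* x :+ n :* x) refl (l j ⁺) (l j ⁻) (x j))
           (+-congʳ (*-congʳ (⁺-⁻ (l j))))) ⟩
    sum (λ j → l j * x j + (l j ⁻) * x j)
      ≈⟨ ∑-distrib-+ (λ j → l j * x j) (λ j → (l j ⁻) * x j) ⟩
    sum (λ j → l j * x j) + sum (λ j → (l j ⁻) * x j)
      ≈⟨ +-congʳ ∑lx≈0 ⟩
    0# + sum (λ j → (l j ⁻) * x j)
      ≈⟨ +-identityˡ _ ⟩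
    sum (λ j → (l j ⁻) * x j) ∎

  sum-*-assoc : ∀ {n} b (w x : Vector Carrier n) →
                sum (λ j → (b * w j) * x j) ≈ b * sum (λ j → w j * x j)
  sum-*-assoc b w x = trans (sum-cong-≋ λ j → *-assoc b (w j) (x j)) (sym (*-distribˡ-sum b (λ j → w j * x j)))

  -- The two sides are weight vectors on the whole index set, and disjointness is stated index by
  -- index. No subsets have to be reindexed, and the sides can be exchanged freely.
  record RadonPartition {d n} (q : Vector (Point d) n) : Set where
    field
      point             : Point d
      α β               : Vector Carrier n
      α-nonNeg          : ∀ j → 0# ≤ α j
      β-nonNeg          : ∀ j → 0# ≤ β j
      disjoint-supports : ∀ j → α j ≈ 0# ⊎ β j ≈ 0#
      sum-α             : sum α ≈ 1#
      sum-β             : sum β ≈ 1#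
      point≈α           : ∀ k → point k ≈ sum (λ j → α j * q j k)
      point≈β           : ∀ k → point k ≈ sum (λ j → β j * q j k)

  swap-partition : ∀ {d n} {q : Vector (Point d) n} → RadonPartition q → RadonPartition q
  swap-partition r = record
    { point = point ; α = β ; β = α ; α-nonNeg = β-nonNeg ; β-nonNeg = α-nonNeg
    ; disjoint-supports = swap ∘ disjoint-supports
    ; sum-α = sum-β ; sum-β = sum-α ; point≈α = point≈β ; point≈β = point≈α }
    where open RadonPartition r

  -- Radon's theorem: `suc (suc d)` points are affinely dependent. The positive and negative parts
  -- of the coefficients have the same positive sum, and dividing by it gives two convex
  -- combinations of the same point.
  radon : ∀ {d} (q : Vector (Point d) (suc (suc d))) → RadonPartition q
  radon {d} q = record
    { point             = λ k → sum (λ j → (b * l j ⁺) * q j k)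
    ; α                 = λ j → b * l j ⁺
    ; β                 = λ j → b * l j ⁻
    ; α-nonNeg          = λ j → *-nonNeg (proj₁ 0<b) (⁺-nonNeg (l j))
    ; β-nonNeg          = λ j → *-nonNeg (proj₁ 0<b) (⁻-nonNeg (l j))
    ; disjoint-supports = λ j → [ inj₁ ∘ b*0 , inj₂ ∘ b*0 ]′ (⁺≈0⊎⁻≈0 (l j))
    ; sum-α             = trans (sym (*-distribˡ-sum b (λ j → l j ⁺))) bs≈1
    ; sum-β             = trans (sym (*-distribˡ-sum b (λ j → l j ⁻))) (trans (*-congˡ (sym ∑l⁺≈∑l⁻)) bs≈1)
    ; point≈α           = λ k → refl
    ; point≈β           = λ k → begin-equality
        sum (λ j → (b * l j ⁺) * q j k)    ≈⟨ sum-*-assoc b (λ j → l j ⁺) (λ j → q j k) ⟩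
        b * sum (λ j → (l j ⁺) * q j k)    ≈⟨ *-congˡ (sum-⁺-⁻ l (λ j → q j k) (proj₂ (proj₂ dep) (suc k))) ⟩
        b * sum (λ j → (l j ⁻) * q j k)    ≈⟨ sum-*-assoc b (λ j → l j ⁻) (λ j → q j k) ⟨
        sum (λ j → (b * l j ⁻) * q j k)    ∎
    }
    where
    -- The extra coordinate `1#` makes the dependence affine: its equation says that the
    -- coefficients sum to zero.
    dep = linear-dependence (λ j → 1# ◁ q j)
    l   = proj₁ dep

    s = sum (λ j → l j ⁺)

    ∑l⁺≈∑l⁻ : s ≈ sum (λ j → l j ⁻)
    ∑l⁺≈∑l⁻ = begin-equality
      s                            ≈⟨ sum-cong-≋ (λ j → *-identityʳ (l j ⁺)) ⟨
      sum (λ j → (l j ⁺) * 1#)     ≈⟨ sum-⁺-⁻ l (λ _ → 1#) (proj₂ (proj₂ dep) zero) ⟩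
      sum (λ j → (l j ⁻) * 1#)     ≈⟨ sum-cong-≋ (λ j → *-identityʳ (l j ⁻)) ⟩
      sum (λ j → l j ⁻)            ∎

    -- Some coefficient is nonzero. If it is negative, it makes the sum of the negative parts
    -- positive, and that sum equals `s`.
    0<s : 0# < s
    0<s with j , lj≉0 ← proj₁ (proj₂ dep) with sign-cases (l j)
    ... | inj₁ (⁺≈ , _) = sum-pos (⁺-nonNeg ∘ l) {j} λ ⁺≈0 → lj≉0 (trans (sym ⁺≈) ⁺≈0)
    ... | inj₂ (_ , ⁻≈) = <-respʳ-≈ (sym ∑l⁺≈∑l⁻) (sum-pos (⁻-nonNeg ∘ l) {j} λ ⁻≈0 → lj≉0 (begin-equality
      l j            ≈⟨ solve 1 (λ x → x := :- (:- x)) refl (l j) ⟩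
      - - l j        ≈⟨ -‿cong ⁻≈ ⟨
      - (l j ⁻)      ≈⟨ -‿cong ⁻≈0 ⟩
      - 0#           ≈⟨ solve 0 (:- con 0ℤ := con 0ℤ) refl ⟩
      0#             ∎))

    b   = proj₁ (positive-inverse 0<s)
    0<b = proj₂ (proj₂ (positive-inverse 0<s))

    bs≈1 : b * s ≈ 1#
    bs≈1 = trans (*-comm b s) (proj₁ (proj₂ (positive-inverse 0<s)))

    b*0 : ∀ {x} → x ≈ 0# → b * x ≈ 0#
    b*0 x≈0 = trans (*-congˡ x≈0) (zeroʳ b)

  -- The expression agrees with the one in `IsConvex`, so convexity applies to it directly; `t`
  -- measures the way from the first point to the second.
  segment : ∀ {d} → Carrier → Point d → Point d → Point d
  segment t = zipWith (λ a b → (1# - t) * a + t * b)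

  -- The weights are not normalised, so that the induction can drop a summand.
  convex-combination : ∀ {d n} {P : Pred (Point d) 0ℓ} → P Respects _≋_ → IsConvex P →
    (w : Vector Carrier n) (q : Vector (Point d) n) (z : Point d) →
    (∀ j → 0# ≤ w j) → (∀ j → w j ≈ 0# ⊎ q j ∈ P) → 0# < sum w →
    (∀ k → sum w * z k ≈ sum (λ j → w j * q j k)) → z ∈ P
  convex-combination {n = zero} _ _ _ _ _ _ _ 0<0 _ = ⊥-elim (<-irrefl refl 0<0)
  convex-combination {n = suc n} {P} resp conv w q z 0≤w supp 0<s sz≈ with supp zero
  ... | inj₁ w₀≈0 = convex-combination resp conv (tail w) (tail q) z (0≤w ∘ suc) (supp ∘ suc)
    (<-respʳ-≈ s≈ 0<s) λ k → begin-equality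
      sum (tail w) * z k                       ≈⟨ *-congʳ s≈ ⟨
      sum w * z k                              ≈⟨ sz≈ k ⟩
      w zero * q zero k + _                    ≈⟨ +-congʳ (trans (*-congʳ w₀≈0) (zeroˡ _)) ⟩
      0# + sum (λ j → w (suc j) * q (suc j) k) ≈⟨ +-identityˡ _ ⟩
      sum (λ j → w (suc j) * q (suc j) k)      ∎
    where
    s≈ : sum w ≈ sum (tail w)
    s≈ = trans (+-congʳ w₀≈0) (+-identityˡ _)
  ... | inj₂ q₀∈P with em {sum (tail w) ≈ 0#}
  -- All the weight sits on `q zero`, so `z` equals that point.
  ...   | yes r≈0 = resp (λ k → *-cancelˡ (<⇒≉ 0<s ∘ sym) (begin-equality
      sum w * q zero k                         ≈⟨ *-congʳ (trans (+-congˡ r≈0) (+-identityʳ _)) ⟩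
      w zero * q zero k                        ≈⟨ +-identityʳ _ ⟨
      w zero * q zero k + 0#                   ≈⟨ +-congˡ (sum-zero λ j →
        trans (*-congʳ (sum≈0⇒≈0 (0≤w ∘ suc) r≈0 j)) (zeroˡ (q (suc j) k))) ⟨
      w zero * q zero k + _                    ≈⟨ sz≈ k ⟨
      sum w * z k                              ∎)) q₀∈P
  ...   | no r≉0 = resp segment≋z (conv q₀∈P y∈P t 0≤t t≤1)
    where
    r = sum (tail w)
    0<r : 0# < r
    0<r = ≤∧≉⇒< (sum-nonNeg (0≤w ∘ suc)) (r≉0 ∘ sym)
    r⁻¹ = proj₁ (positive-inverse 0<r)
    s⁻¹ = proj₁ (positive-inverse 0<s)
    ss⁻¹≈1 = proj₁ (proj₂ (positive-inverse 0<s))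
    -- The share of the tail in the total weight: `z` divides the segment from `q zero` to the
    -- barycentre `y` of the tail in this ratio.
    t = s⁻¹ * r

    y : Point _
    y k = r⁻¹ * sum (λ j → w (suc j) * q (suc j) k)

    ry≈ : ∀ k → r * y k ≈ sum (λ j → w (suc j) * q (suc j) k)
    ry≈ k = trans (sym (*-assoc r r⁻¹ _))
      (trans (*-congʳ (proj₁ (proj₂ (positive-inverse 0<r)))) (*-identityˡ _))

    y∈P : y ∈ P
    y∈P = convex-combination resp conv (tail w) (tail q) y (0≤w ∘ suc) (supp ∘ suc) 0<r ry≈

    0≤t : 0# ≤ t
    0≤t = *-nonNeg (proj₁ (proj₂ (proj₂ (positive-inverse 0<s)))) (proj₁ 0<r)

    1-t≈ : 1# - t ≈ s⁻¹ * w zero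
    1-t≈ = trans (+-congʳ (sym ss⁻¹≈1))
      (solve 3 (λ w r b → (w :+ r) :* b :- b :* r := b :* w) refl (w zero) r s⁻¹)

    t≤1 : t ≤ 1#
    t≤1 = 0≤y-x⇒x≤y (≤.trans
      (*-nonNeg (proj₁ (proj₂ (proj₂ (positive-inverse 0<s)))) (0≤w zero)) (≤.reflexive (sym 1-t≈)))

    segment≋z : segment t (q zero) y ≋ z
    segment≋z k = begin-equality
      (1# - t) * q zero k + t * y k                ≈⟨ +-congʳ (*-congʳ 1-t≈) ⟩
      (s⁻¹ * w zero) * q zero k + (s⁻¹ * r) * y k  ≈⟨ solve 5
        (λ b w q r y → (b :* w) :* q :+ (b :* r) :* y := b :* (w :* q :+ r :* y)) refl s⁻¹ (w zero) (q zero k) r (y k) ⟩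
      s⁻¹ * (w zero * q zero k + r * y k)          ≈⟨ *-congˡ (trans (+-congˡ (ry≈ k)) (sym (sz≈ k))) ⟩
      s⁻¹ * (sum w * z k)                          ≈⟨ solve 3 (λ b s z → b :* (s :* z) := (s :* b) :* z) refl s⁻¹ (sum w) (z k) ⟩
      (sum w * s⁻¹) * z k                          ≈⟨ trans (*-congʳ ss⁻¹≈1) (*-identityˡ (z k)) ⟩
      z k                                          ∎

-- The sup metric, minima on compact sets and nearest points.

module Compactness (em : ExcludedMiddle 0ℓ) (ℝ : RealNumbers) where
  open RealNumbers ℝ hiding (zero)
  open Euclidean ℝ
  open OrderedField em ℝ
  open Convexity em ℝ
  open ≤-Reasoning

  ∣_∣ : Carrier → Carrier
  ∣ x ∣ = x ⊔ - x

  x≤∣x∣ : ∀ x → x ≤ ∣ x ∣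
  x≤∣x∣ x = x≤x⊔y x (- x)

  -x≤∣x∣ : ∀ x → - x ≤ ∣ x ∣
  -x≤∣x∣ x = x≤y⊔x x (- x)

  ∣x∣≈x⊎∣x∣≈-x : ∀ x → ∣ x ∣ ≈ x ⊎ ∣ x ∣ ≈ - x
  ∣x∣≈x⊎∣x∣≈-x x = ⊔-sel x (- x)

  ∣x∣²≈x² : ∀ x → ∣ x ∣ * ∣ x ∣ ≈ x * x
  ∣x∣²≈x² x = [ (λ eq → *-cong eq eq)
              , (λ eq → trans (*-cong eq eq) (solve 1 (λ x → :- x :* :- x := x :* x) refl x)) ]′ (∣x∣≈x⊎∣x∣≈-x x)

  ∣x∣<ε : ∀ {x ε} → 0# < ε → x * x < ε * ε → ∣ x ∣ < ε
  ∣x∣<ε {x} {ε} 0<ε x²<ε² = ≰⇒> λ ε≤∣x∣ → <⇒≱ x²<ε² (begin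
    ε * ε          ≤⟨ *-mono-≤ (≤.trans (proj₁ 0<ε) ε≤∣x∣) (proj₁ 0<ε) ε≤∣x∣ ε≤∣x∣ ⟩
    ∣ x ∣ * ∣ x ∣  ≈⟨ ∣x∣²≈x² x ⟩
    x * x          ∎)

  -- The start value `0#` covers dimension zero and does not alter a maximum of absolute values, the
  -- case used in `δ`.
  max : ∀ {n} → Vector Carrier n → Carrier
  max = foldr _⊔_ 0#

  ≤-max : ∀ {n} (x : Vector Carrier n) k → x k ≤ max x
  ≤-max x zero    = x≤x⊔y (x zero) (max (tail x))
  ≤-max x (suc k) = ≤.trans (≤-max (tail x) k) (x≤y⊔x (x zero) (max (tail x)))

  0≤max : ∀ {n} (x : Vector Carrier n) → 0# ≤ max x
  0≤max {zero}  x = ≤.refl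
  0≤max {suc n} x = ≤.trans (0≤max (tail x)) (x≤y⊔x (x zero) (max (tail x)))

  max-≤ : ∀ {n} {x : Vector Carrier n} {r} → 0# ≤ r → (∀ k → x k ≤ r) → max x ≤ r
  max-≤ {zero}  0≤r x≤r = 0≤r
  max-≤ {suc n} 0≤r x≤r = ⊔-lub (x≤r zero) (max-≤ 0≤r (x≤r ∘ suc))

  max-< : ∀ {n} {x : Vector Carrier n} {r} → 0# < r → (∀ k → x k < r) → max x < r
  max-< {zero}  0<r x<r = 0<r
  max-< {suc n} {x} 0<r x<r = [ (λ eq → <-respˡ-≈ (sym eq) (x<r zero))
    , (λ eq → <-respˡ-≈ (sym eq) (max-< 0<r (x<r ∘ suc))) ]′ (⊔-sel (x zero) (max (tail x)))

  -- The sup metric: unlike the Euclidean one, its triangle inequality needs no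
  -- square roots.
  δ : ∀ {d} → Point d → Point d → Carrier
  δ x y = max (zipWith (λ a b → ∣ a - b ∣) x y)

  0≤δ : ∀ {d} (x y : Point d) → 0# ≤ δ x y
  0≤δ x y = 0≤max (zipWith (λ a b → ∣ a - b ∣) x y)

  x-y≤δ : ∀ {d} (x y : Point d) k → x k - y k ≤ δ x y
  x-y≤δ x y k = ≤.trans (x≤∣x∣ (x k - y k)) (≤-max (zipWith (λ a b → ∣ a - b ∣) x y) k)

  y-x≤δ : ∀ {d} (x y : Point d) k → y k - x k ≤ δ x y
  y-x≤δ x y k = begin
    y k - x k        ≈⟨ solve 2 (λ x y → y :- x := :- (x :- y)) refl (x k) (y k) ⟩
    - (x k - y k)    ≤⟨ -x≤∣x∣ (x k - y k) ⟩
    ∣ x k - y k ∣    ≤⟨ ≤-max (zipWith (λ a b → ∣ a - b ∣) x y) k ⟩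
    δ x y            ∎

  δ-≤ : ∀ {d} {x y : Point d} {r} → 0# ≤ r → (∀ k → x k - y k ≤ r) → (∀ k → y k - x k ≤ r) → δ x y ≤ r
  δ-≤ {x = x} {y} 0≤r x-y≤r y-x≤r = max-≤ 0≤r λ k → ⊔-lub (x-y≤r k) (begin
    - (x k - y k)  ≈⟨ solve 2 (λ x y → :- (x :- y) := y :- x) refl (x k) (y k) ⟩
    y k - x k      ≤⟨ y-x≤r k ⟩
    _              ∎)

  δ-sym : ∀ {d} (x y : Point d) → δ x y ≤ δ y x
  δ-sym x y = δ-≤ (0≤δ y x) (y-x≤δ y x) (x-y≤δ y x)

  δ-triangle : ∀ {d} (x y z : Point d) → δ x z ≤ δ x y + δ y z
  δ-triangle x y z = δ-≤
    (≤.trans (≤.reflexive (sym (+-identityˡ 0#))) (+-mono-≤ (0≤δ x y) (0≤δ y z)))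
    (λ k → ≤.trans (≤.reflexive (solve 3 (λ x y z → x :- z := (x :- y) :+ (y :- z)) refl (x k) (y k) (z k)))
                   (+-mono-≤ (x-y≤δ x y k) (x-y≤δ y z k)))
    (λ k → ≤.trans (≤.reflexive (solve 3 (λ x y z → z :- x := (y :- x) :+ (z :- y)) refl (x k) (y k) (z k)))
                   (+-mono-≤ (y-x≤δ x y k) (y-x≤δ y z k)))

  δ≤0⇒≋ : ∀ {d} {x y : Point d} → δ x y ≤ 0# → x ≋ y
  δ≤0⇒≋ {x = x} {y} δ≤0 k = ≤.antisym (≤-from (y-x≤δ y x) (δ-sym y x)) (≤-from (y-x≤δ x y) ≤.refl)
    where
    ≤-from : ∀ {u v : Point _} → (∀ k → v k - u k ≤ δ u v) → δ u v ≤ δ x y → v k ≤ u k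
    ≤-from {u} {v} v-u≤ le = 0≤y-x⇒x≤y (begin
      0#             ≤⟨ x≤0⇒0≤-x (≤.trans (v-u≤ k) (≤.trans le δ≤0)) ⟩
      - (v k - u k)  ≈⟨ solve 2 (λ u v → :- (v :- u) := u :- v) refl (u k) (v k) ⟩
      u k - v k      ∎)

  δ-refl : ∀ {d} (x : Point d) → δ x x ≤ 0#
  δ-refl x = δ-≤ ≤.refl (λ k → ≤.reflexive (-‿inverseʳ (x k))) (λ k → ≤.reflexive (-‿inverseʳ (x k)))

  -- The common endpoint `z` cancels in each coordinate difference, leaving the factor `1# - t`.
  δ-segment : ∀ {d} {t} → t ≤ 1# → (x y z : Point d) →
              δ (segment t x z) (segment t y z) ≤ (1# - t) * δ x y
  δ-segment {t = t} t≤1 x y z = δ-≤ (*-nonNeg 0≤1-t (0≤δ x y))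
    (λ k → ≤.trans (≤.reflexive (lemma (x k) (y k) (z k))) (*-monoˡ-≤ 0≤1-t (x-y≤δ x y k)))
    (λ k → ≤.trans (≤.reflexive (lemma (y k) (x k) (z k))) (*-monoˡ-≤ 0≤1-t (y-x≤δ x y k)))
    where
    0≤1-t = x≤y⇒0≤y-x t≤1
    lemma : ∀ a b c → ((1# - t) * a + t * c) - ((1# - t) * b + t * c) ≈ (1# - t) * (a - b)
    lemma a b c = solve 4 (λ s a b tc → (s :* a :+ tc) :- (s :* b :+ tc) := s :* (a :- b))
      refl (1# - t) a b (t * c)

  -- Each squared coordinate difference is a summand of `dist²`. Thus Euclidean balls lie in
  -- sup-metric balls, which is the direction that openness proofs call for.
  ball⇒δ< : ∀ {d} {x y : Point d} {ε} → 0# < ε → y ∈ Ball x ε → δ x y < ε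
  ball⇒δ< {x = x} {y} 0<ε y∈B = max-< 0<ε λ k → ∣x∣<ε 0<ε (begin-strict
    (x k - y k) * (x k - y k)  ≤⟨ summand≤sum (λ j → square-nonNeg (x j - y j)) k ⟩
    dist² x y                  <⟨ y∈B ⟩
    _                          ∎)

  -- Lipschitz constant one for `δ`. The one-sided bound suffices, as the two points may be
  -- exchanged.
  Lipschitz : ∀ {d} → (Point d → Carrier) → Set
  Lipschitz f = ∀ x y → f x ≤ f y + δ x y

  -- The radius is the excess `f x - a`: within it `f` cannot drop to `a`.
  superlevel-open : ∀ {d} {f : Point d → Carrier} → Lipschitz f → ∀ a → IsOpen (λ x → a < f x)
  superlevel-open {f = f} lip a {x} a<fx = f x - a , x<y⇒0<y-x a<fx , λ {y} y∈B → ≰⇒> λ fy≤a →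
    <⇒≱ (ball⇒δ< {x = x} {y} (x<y⇒0<y-x a<fx) y∈B) (begin
      f x - a              ≤⟨ +-monoˡ-≤ (- a) (lip x y) ⟩
      (f y + δ x y) - a    ≤⟨ +-monoˡ-≤ (- a) (+-monoˡ-≤ (δ x y) fy≤a) ⟩
      (a + δ x y) - a      ≈⟨ solve 2 (λ a e → (a :+ e) :- a := e) refl a (δ x y) ⟩
      δ x y                ∎)

  -- If no minimum were attained, the open sets where `f` exceeds `f q`, for `q` in `K`, would cover
  -- `K`. Among the finitely many `q` of a subcover one with the least value lies in none of these
  -- sets, a contradiction.
  minimiser : ∀ {d} {K : Pred (Point d) 0ℓ} → IsCompact K → Satisfiable K →
              (f : Point d → Carrier) → Lipschitz f →
              Σ[ p ∈ Point d ] (p ∈ K × (∀ {q} → q ∈ K → f p ≤ f q))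
  minimiser {d} {K} compact (k₀ , k₀∈K) f lip
    with em {Σ[ p ∈ Point d ] (p ∈ K × (∀ {q} → q ∈ K → f p ≤ f q))}
  ... | yes min = min
  ... | no ∄min = ⊥-elim (proj₂ (proj₂ best) (proj₂ cover (proj₁ (proj₂ best))))
    where
    I : Set
    I = Σ[ q ∈ Point d ] q ∈ K

    U : I → Pred (Point d) 0ℓ
    U (q , _) x = f q < f x

    smaller : ∀ {x} → x ∈ K → ∃[ i ] x ∈ U i
    smaller {x} x∈K = decidable-stable em λ ∄i → ∄min (x , x∈K , λ {q} q∈K →
      decidable-stable em λ fx≰fq → ∄i ((q , q∈K) , ≰⇒> fx≰fq))

    cover : Σ[ is ∈ List I ] (∀ {x} → x ∈ K → Any (λ i → x ∈ U i) is)
    cover = compact I U (λ (q , _) → superlevel-open {f = f} lip (f q)) smaller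

    least : (is : List I) → Σ[ p ∈ Point d ] (p ∈ K × ¬ Any (λ i → p ∈ U i) is)
    -- The given point of `K` starts the recursion, so an empty subcover is refuted as well.
    least [] = k₀ , k₀∈K , λ ()
    least ((q , q∈K) ∷ is) with p , p∈K , p-least ← least is with em {f q < f p}
    ... | no  fq≮fp = p , p∈K , λ { (here fq<fp) → fq≮fp fq<fp ; (there ∃i) → p-least ∃i }
    ... | yes fq<fp = q , q∈K , λ { (here fq<fq) → <-irrefl refl fq<fq
                                 ; (there ∃i) → p-least (Any.map (λ fi<fq → <-trans fi<fq fq<fp) ∃i) }

    best : Σ[ p ∈ Point d ] (p ∈ K × ¬ Any (λ i → p ∈ U i) (proj₁ cover))
    best = least (proj₁ cover)

  -- The complement of `F`, under the index `nothing`, completes a cover of `F` to a cover of `K`;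
  -- dropping it from the finite subcover still leaves `F` covered.
  closed-subset : ∀ {d} {K F : Pred (Point d) 0ℓ} → IsCompact K → F ⊆ K → IsClosed F → IsCompact F
  closed-subset {d} {K} {F} compact F⊆K closed I U open-U U-covers =
    mapMaybe id (proj₁ cover) , λ x∈F → select x∈F (proj₁ cover) (proj₂ cover (F⊆K x∈F))
    where
    V : Maybe I → Pred (Point d) 0ℓ
    V = maybe′ U (∁ F)

    open-V : ∀ i → IsOpen (V i)
    open-V (just i) = open-U i
    open-V nothing  = closed

    V-covers : ∀ {x} → x ∈ K → ∃[ i ] x ∈ V i
    V-covers {x} _ with em {x ∈ F}
    ... | yes x∈F with i , x∈Ui ← U-covers x∈F = just i , x∈Ui
    ... | no  x∉F = nothing , x∉F

    cover = compact (Maybe I) V open-V V-covers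

    select : ∀ {x} → x ∈ F → ∀ is → Any (λ i → x ∈ V i) is → Any (λ i → x ∈ U i) (mapMaybe id is)
    select x∈F (just i ∷ is)  (here x∈Ui) = here x∈Ui
    select x∈F (nothing ∷ is) (here x∉F)  = ⊥-elim (x∉F x∈F)
    select x∈F (just i ∷ is)  (there ∃i)  = there (select x∈F is ∃i)
    select x∈F (nothing ∷ is) (there ∃i)  = select x∈F is ∃i

  -- Equal points are at distance zero, so any ball around `y` contains `x`; if `y` were outside
  -- `M`, some such ball would avoid `M`.
  closed⇒respects : ∀ {d} {M : Pred (Point d) 0ℓ} → IsClosed M → M Respects _≋_
  closed⇒respects {M = M} closed {x} {y} x≋y x∈M = decidable-stable em λ y∉M →
    let ε , 0<ε , ball⊆ = closed y∉M in
    ball⊆ (<-respˡ-≈ (sym (sum-zero λ k → begin-equality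
      (y k - x k) * (y k - x k)  ≈⟨ *-congʳ (trans (+-congˡ (-‿cong (x≋y k))) (-‿inverseʳ (y k))) ⟩
      0# * (y k - x k)           ≈⟨ zeroˡ _ ⟩
      0#                         ∎)) (*-pos 0<ε 0<ε)) x∈M

  -- Nearest points in the sup metric need not be unique, so `π` records a choice of them. `gap` is
  -- the distance to `C`.
  record NearestPoints {d} (C : Pred (Point d) 0ℓ) : Set where
    field
      π         : Point d → Point d
      π∈C       : ∀ x → π x ∈ C
      π-nearest : ∀ x {c} → c ∈ C → δ (π x) x ≤ δ c x

    gap : Point d → Carrier
    gap x = δ (π x) x

    gap≤ : ∀ {x c} → c ∈ C → gap x ≤ δ c x
    gap≤ {x} = π-nearest x

    -- The point of `C` chosen for `y` competes with the one chosen for `x`.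
    gap-lipschitz : Lipschitz gap
    gap-lipschitz x y = begin
      gap x              ≤⟨ gap≤ (π∈C y) ⟩
      δ (π y) x          ≤⟨ δ-triangle (π y) y x ⟩
      gap y + δ y x      ≤⟨ +-mono-≤ ≤.refl (δ-sym y x) ⟩
      gap y + δ x y      ∎

    gap-pos : C Respects _≋_ → ∀ {x} → ¬ (x ∈ C) → 0# < gap x
    gap-pos resp {x} x∉C = ≰⇒> λ gap≤0 → x∉C (resp (δ≤0⇒≋ gap≤0) (π∈C x))

    -- The complement of `C` is the set where `gap` is positive, a superlevel set of a Lipschitz
    -- function.
    closed : C Respects _≋_ → IsClosed C
    closed resp x∉C =
      let ε , 0<ε , ball⊆ = superlevel-open {f = gap} gap-lipschitz 0# (gap-pos resp x∉C) in
      ε , 0<ε , λ {y} y∈B y∈C → <⇒≱ (ball⊆ y∈B) (≤.trans (gap≤ y∈C) (δ-refl y))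

  nearest-points : ∀ {d} {C : Pred (Point d) 0ℓ} → IsCompact C → Satisfiable C → NearestPoints C
  nearest-points {d} {C} compact nonempty = record
    { π         = λ x → proj₁ (nearest x)
    ; π∈C       = λ x → proj₁ (proj₂ (nearest x))
    ; π-nearest = λ x → proj₂ (proj₂ (nearest x))
    }
    where
    nearest : ∀ x → Σ[ c ∈ Point d ] (c ∈ C × (∀ {c′} → c′ ∈ C → δ c x ≤ δ c′ x))
    nearest x = minimiser compact nonempty (λ c → δ c x) λ c c′ → begin
      δ c x            ≤⟨ δ-triangle c c′ x ⟩
      δ c c′ + δ c′ x  ≈⟨ +-comm (δ c c′) (δ c′ x) ⟩
      δ c′ x + δ c c′  ∎

  -- Take `p` minimising `gap` on `K`. Moving both `p` and `π p` towards `c` keeps the latter in `C`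
  -- by convexity and scales their distance by `1# - t`. The positive gap therefore drops strictly,
  -- so the moved point cannot lie in `K`.
  shielding-point : ∀ {d} {K C : Pred (Point d) 0ℓ} → IsCompact K → Satisfiable K →
    C Respects _≋_ → IsConvex C → NearestPoints C → (∀ {x} → x ∈ K → ¬ (x ∈ C)) →
    Σ[ p ∈ Point d ] (p ∈ K × (∀ {c t} → c ∈ C → 0# < t → t ≤ 1# → ¬ (segment t p c ∈ K)))
  shielding-point {K = K} {C} compact nonempty resp convex nearest K∩C=∅ =
    shield (minimiser compact nonempty gap gap-lipschitz)
    where
    open NearestPoints nearest
    shield : Σ[ p ∈ Point _ ] (p ∈ K × (∀ {q} → q ∈ K → gap p ≤ gap q)) →
             Σ[ p ∈ Point _ ] (p ∈ K × (∀ {c t} → c ∈ C → 0# < t → t ≤ 1# → ¬ (segment t p c ∈ K)))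
    shield (p , p∈K , p-least) = p , p∈K , λ {c} {t} c∈C 0<t t≤1 z∈K →
      <⇒≱ (contract-< 0<t (gap-pos resp (K∩C=∅ p∈K))) (begin
        gap p                                  ≤⟨ p-least z∈K ⟩
        gap (segment t p c)                    ≤⟨ gap≤ (convex (π∈C p) c∈C t (proj₁ 0<t) t≤1) ⟩
        δ (segment t (π p) c) (segment t p c)  ≤⟨ δ-segment t≤1 (π p) p c ⟩
        (1# - t) * gap p                       ∎)

-- Shielding points of a critical family and their membership in convex sets.

module CriticalFamily (em : ExcludedMiddle 0ℓ) (ℝ : RealNumbers) where
  open RealNumbers ℝ hiding (zero)
  open Euclidean ℝ
  open OrderedField em ℝ
  open Convexity em ℝ
  open Compactness em ℝ
  open ≤-Reasoning

  module _ {d} {C : Fin (suc d) → Pred (Point d) 0ℓ} (critical : IsCritical d C) where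
    open IsCritical critical

    Shields : Fin (suc d) → Point d → Set
    Shields i p = ∀ {c t} → c ∈ C i → 0# < t → t ≤ 1# → ¬ (segment t p c ∈ ⋂-except C i)

    not-in-all : ∀ {i x} → x ∈ ⋂-except C i → ¬ (x ∈ C i)
    not-in-all {i} {x} x∈K x∈Cᵢ = disjoint x λ j → case-≟ j
      where
      case-≟ : ∀ j → x ∈ C j
      case-≟ j with j ≟ i
      ... | yes ≡.refl = x∈Cᵢ
      ... | no j≢i     = x∈K j j≢i

    -- A second index `j` is used twice: the intersection is compact as a closed part of `C j`, and
    -- `C i` is nonempty because it contains the intersection that omits `C j`.
    shielding-base-point : ∀ i {j} → j ≢ i → Σ[ p ∈ Point d ] (p ∈ ⋂-except C i × Shields i p)
    shielding-base-point i {j} j≢i = shielding-point {K = ⋂-except C i} {C i}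
      K-compact (meets i) (respects i) (convex i)
      (nearest-points {C = C i} (compact i) (nonempty (j≢i ∘ ≡.sym))) not-in-all
      where
      nonempty : ∀ {k l} → k ≢ l → Satisfiable (C k)
      nonempty {k} {l} k≢l = proj₁ (meets l) , proj₂ (meets l) k k≢l

      member-closed : ∀ {k l} → k ≢ l → IsClosed (C k)
      member-closed {k} k≢l = NearestPoints.closed (nearest-points {C = C k} (compact k) (nonempty k≢l)) (respects k)

      K-closed : IsClosed (⋂-except C i)
      K-closed {x} x∉K with em {Σ[ k ∈ Fin (suc d) ] (k ≢ i × ¬ (x ∈ C k))}
      ... | yes (k , k≢i , x∉Cₖ) =
        let ε , 0<ε , ball⊆ = member-closed k≢i x∉Cₖ in
        ε , 0<ε , λ {y} y∈B y∈K → ball⊆ {y} y∈B (y∈K k k≢i)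
      ... | no ∄k = ⊥-elim (x∉K λ k k≢i → decidable-stable em λ x∉Cₖ → ∄k (k , k≢i , x∉Cₖ))

      K-compact : IsCompact (⋂-except C i)
      K-compact = closed-subset {K = C j} {⋂-except C i} (compact j) (λ x∈K → x∈K j j≢i) K-closed

    -- Neither hypothesis on `p` mentions `a` or `M`, so the same `p` serves every cage. Closedness
    -- of a cage enters through `M Respects _≋_`.
    shielding-point∈convex : ∀ {i p} → p ∈ ⋂-except C i → Shields i p →
      ∀ {a} → IsBase C a → ∀ {M} → M Respects _≋_ → IsConvex M → (∀ j → a j ∈ M) → p ∈ M
    shielding-point∈convex {i} {p} p∈K shields {a} a-base {M} M-resp M-convex a∈M =
      -- Index `zero` is `p` and index `suc j` is `a j`. The sides are exchanged if necessary, so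
      -- that `p` has weight zero on the side called `β`.
      [ conclude (swap-partition partition) , conclude partition ]′
        (RadonPartition.disjoint-supports partition zero)
      where
      partition = radon (p ◁ a)

      conclude : (r : RadonPartition (p ◁ a)) → RadonPartition.β r zero ≈ 0# → p ∈ M
      conclude r β₀≈0 = [ αᵢ≈0⇒p∈M , ⊥-elim ∘ βᵢ≉0 ]′ (disjoint-supports (suc i))
        where
        open RadonPartition r renaming (point to z)

        combination∈ : ∀ {P : Pred (Point d) 0ℓ} → P Respects _≋_ → IsConvex P → (w : Vector Carrier _) →
          (∀ j → 0# ≤ w j) → sum w ≈ 1# → (∀ k → z k ≈ sum (λ j → w j * (p ◁ a) j k)) →
          (∀ j → w j ≈ 0# ⊎ (p ◁ a) j ∈ P) → z ∈ P
        combination∈ resp conv w 0≤w ∑w≈1 z≈ supp = convex-combination resp conv w (p ◁ a) z 0≤w supp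
          (<-respʳ-≈ (sym ∑w≈1) 0<1) λ k → trans (trans (*-congʳ ∑w≈1) (*-identityˡ (z k))) (z≈ k)

        α∈ : ∀ {P : Pred (Point d) 0ℓ} → P Respects _≋_ → IsConvex P →
             (∀ j → α j ≈ 0# ⊎ (p ◁ a) j ∈ P) → z ∈ P
        α∈ resp conv = combination∈ resp conv α α-nonNeg sum-α point≈α

        β∈ : ∀ {P : Pred (Point d) 0ℓ} → P Respects _≋_ → IsConvex P →
             (∀ j → β j ≈ 0# ⊎ (p ◁ a) j ∈ P) → z ∈ P
        β∈ resp conv = combination∈ resp conv β β-nonNeg sum-β point≈β

        support : ∀ {w : Vector Carrier (suc d)} {j} → w j ≈ 0# → ∀ m → w m ≈ 0# ⊎ a m ∈ C j
        support {j = j} wj≈0 m with j ≟ m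
        ... | yes ≡.refl = inj₁ wj≈0
        ... | no j≢m     = inj₂ (a-base m j j≢m)

        z∈K : z ∈ ⋂-except C i
        z∈K j j≢i with disjoint-supports (suc j)
        ... | inj₁ αⱼ≈0 = α∈ (respects j) (convex j)
          λ { zero → inj₂ (p∈K j j≢i) ; (suc m) → support {tail α} αⱼ≈0 m }
        ... | inj₂ βⱼ≈0 = β∈ (respects j) (convex j)
          λ { zero → inj₂ (p∈K j j≢i) ; (suc m) → support {tail β} βⱼ≈0 m }

        -- Without `a i`, the `β` side would use only points of `C i`, putting `z` in every member
        -- of the family.
        βᵢ≉0 : ¬ (β (suc i) ≈ 0#)
        βᵢ≉0 βᵢ≈0 = not-in-all z∈K (β∈ (respects i) (convex i)
          λ { zero → inj₁ β₀≈0 ; (suc m) → support {tail β} βᵢ≈0 m })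

        -- The weight of the base points on the side of `p`; it is the position of `z` on a segment
        -- starting at `p`.
        t = sum (tail α)

        1-t≈α₀ : 1# - t ≈ α zero
        1-t≈α₀ = trans (+-congʳ (sym sum-α)) (solve 2 (λ a t → (a :+ t) :- t := a) refl (α zero) t)

        t≤1 : t ≤ 1#
        t≤1 = 0≤y-x⇒x≤y (≤.trans (α-nonNeg zero) (≤.reflexive (sym 1-t≈α₀)))

        αᵢ≈0⇒p∈M : α (suc i) ≈ 0# → p ∈ M
        αᵢ≈0⇒p∈M αᵢ≈0 with em {t ≈ 0#}
        -- Here `z` equals `p`, and the `β` side writes `z` through points of `M` alone.
        ... | yes t≈0 = M-resp (λ k → begin-equality
                z k                                          ≈⟨ point≈α k ⟩
                α zero * p k + sum (λ j → α (suc j) * a j k) ≈⟨ +-cong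
                  (*-congʳ (trans (sym 1-t≈α₀) (+-congˡ (-‿cong t≈0))))
                  (sum-zero λ j → trans (*-congʳ (sum≈0⇒≈0 (α-nonNeg ∘ suc) t≈0 j)) (zeroˡ (a j k))) ⟩
                (1# - 0#) * p k + 0#                         ≈⟨ solve 1 (λ x → (con 1ℤ :- con 0ℤ) :* x :+ con 0ℤ := x) refl (p k) ⟩
                p k                                          ∎)
              (β∈ M-resp M-convex λ { zero → inj₁ β₀≈0 ; (suc m) → inj₂ (a∈M m) })
        -- The barycentre `c` of the base points on the `α` side lies in `C i`, since `a i` has
        -- weight zero there. Then `z` lies in the intersection and strictly beyond `p` on the way
        -- to `c`, against shielding.
        ... | no t≉0 = ⊥-elim (shields c∈Cᵢ 0<t t≤1 λ j j≢i → respects j z≋segment (z∈K j j≢i))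
          where
          0<t : 0# < t
          0<t = ≤∧≉⇒< (sum-nonNeg (α-nonNeg ∘ suc)) (t≉0 ∘ sym)

          t⁻¹ = proj₁ (positive-inverse 0<t)

          c : Point d
          c k = t⁻¹ * sum (λ j → α (suc j) * a j k)

          tc≈ : ∀ k → t * c k ≈ sum (λ j → α (suc j) * a j k)
          tc≈ k = trans (sym (*-assoc t t⁻¹ _))
            (trans (*-congʳ (proj₁ (proj₂ (positive-inverse 0<t)))) (*-identityˡ _))

          c∈Cᵢ : c ∈ C i
          c∈Cᵢ = convex-combination (respects i) (convex i) (tail α) a c (α-nonNeg ∘ suc)
            (support {tail α} αᵢ≈0) 0<t tc≈

          z≋segment : z ≋ segment t p c
          z≋segment k = trans (point≈α k) (sym (+-cong (*-congʳ 1-t≈α₀) (tc≈ k)))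

theorem3p2 : (∀ {ℓ} → ExcludedMiddle ℓ) → (ℝ : RealNumbers) → let open Euclidean ℝ in
    (d : ℕ) → d ≥ 1 → (C : Fin (suc d) → Pred (Point d) 0ℓ) → IsCritical d C →
    ∃[ p ] (IsBase C p × (∀ M → IsConvexCage C M → ∀ i → p i ∈ M))
theorem3p2 em ℝ (suc d) (s≤s _) C critical =
  (λ i → proj₁ (shielding i)) , (λ i → proj₁ (proj₂ (shielding i))) ,
  λ M (cage , M-convex) i → let open Euclidean.IsCage cage in
    shielding-point∈convex critical (proj₁ (proj₂ (shielding i))) (proj₂ (proj₂ (shielding i)))
      isBase (closed⇒respects closed) M-convex base∈M
  where
  open Compactness em ℝ
  open CriticalFamily em ℝ
  -- `punchIn i zero` is an index other than `i`; it exists because `d ≥ 1` gives the family at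
  -- least two members.
  shielding = λ i → shielding-base-point critical i (punchInᵢ≢i i zero)
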